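{- For every fixed integer $k\geq 3$, $r(B^{(k)},K^{(k)}_n) > 2^{\Omega(n)}$; that is, there is a constant $c=c(k)>0$ such that $r(B^{(k)},K^{(k)}_n) > 2^{cn}$ for all sufficiently large $n$.
   Context: A $k$-half-graph $B^{(k)}$ is the $k$-uniform hypergraph on $2k-2$ vertices with vertex set $S\cup T$, $S\cap T=\emptyset$, $|S|=|T|=k-1$, whose edges are all $k$-subsets of $S\cup T$ containing $S$, together with one $k$-subset containing $T$. $K^{(k)}_n$ is the complete $k$-uniform hypergraph on $n$ vertices. $r(B^{(k)},K^{(k)}_n)$ is the minimum $N$ such that every red-blue coloring of the $k$-subsets of an $N$-element set contains a red copy of $B^{(k)}$ or a blue copy of $K^{(k)}_n$. -}

module Defs where

open import Data.Nat using (ℕ; _∸_)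
open import Data.Bool using (Bool; true; false)
open import Data.Fin using (Fin)
open import Data.Fin.Subset using (Subset; _∈_; _⊆_; _∪_; ⁅_⁆; ∣_∣; Empty; _∩_)
open import Data.Product using (Σ; _×_; ∃; ∃-syntax)
open import Relation.Binary.PropositionalEquality using (_≡_)

-- A red-blue colouring of the k-subsets of an N-element vertex set Fin N.
-- We colour all subsets (only the values on k-subsets matter);
-- true = red, false = blue.
Colouring : ℕ → Set
Colouring N = Subset N → Bool

RedHalfGraph : (k N : ℕ) → Colouring N → Set
RedHalfGraph k N χ =
  Σ (Subset N) λ S → Σ (Subset N) λ T →
    Empty (S ∩ T) × ∣ S ∣ ≡ k ∸ 1 × ∣ T ∣ ≡ k ∸ 1 ×
    ((t : Fin N) → t ∈ T → χ (S ∪ ⁅ t ⁆) ≡ true) ×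
    (Σ (Fin N) λ s → s ∈ S × χ (T ∪ ⁅ s ⁆) ≡ true)

BlueClique : (k n N : ℕ) → Colouring N → Set
BlueClique k n N χ =
  Σ (Subset N) λ X → ∣ X ∣ ≡ n ×
    ((Y : Subset N) → Y ⊆ X → ∣ Y ∣ ≡ k → χ Y ≡ false)

{-# OPTIONS --safe #-}
module Submission where

-- Put h = k − 1 and let w be a random N × N matrix over ℤ/h with zero diagonal.
-- Colour Y red iff ∑_{u ∈ Y} w(v,u) ≡ −1 (mod h) for every v ∈ Y.  If all S ∪ {t},
-- t ∈ T, are red, then w(s,t) does not depend on t, so ∑_{t ∈ T} w(s,t) ≡ 0 and
-- T ∪ {s} is blue.  On the other hand every h-set S extends to a red S ∪ {t} for
-- some choice of the row and column of t on S.  Exposing the vertices of an n-set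
-- one at a time, each new vertex must avoid this choice on a linear number of
-- disjoint h-sets, so the n-set is a blue clique with probability 2^(−Ω(n²)),
-- and a union bound allows N = 2^Ω(n).

open import Defs
open import Data.Nat using (ℕ; zero; suc; _+_; _*_; _∸_; _^_; _≤_; _<_; z≤n; s≤s; NonZero; >-nonZero; >-nonZero⁻¹; _≤?_; _≟_; _/_; _%_)
open import Data.Nat.Properties
open import Data.Nat.Divisibility using (_∣_; _∣?_; divides; ∣m∣n⇒∣m+n; ∣m+n∣m⇒∣n; ∣1⇒≡1; m∣m*n; _∣0)
open import Data.Nat.DivMod using (m≡m%n+[m/n]*n; m%n<n; m/n*n≤m; m≥n⇒m/n>0; _mod_)
open import Data.Nat.Tactic.RingSolver using (solve-∀)
open import Data.Bool using (true)
open import Data.Unit using (⊤; tt)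
open import Data.Fin using (Fin; zero; suc; toℕ; fromℕ; opposite; combine; remQuot)
open import Data.Fin.Properties using (all?; toℕ-fromℕ; toℕ-fromℕ<; opposite-prop; remQuot-combine)
open import Data.Fin.Subset using (Subset; inside; outside; ⊥; _∈_; _∉_; _⊆_; _∪_; ⁅_⁆; ∣_∣)
open import Data.Fin.Subset.Properties using (_∈?_; _⊆?_; anySubset?; ∪-identityʳ; ∉⊥; x∈p∩q⁺; x∈p∪q⁺; x∈⁅x⁆; out⊆; s⊆s; ∣⊥∣≡0)
open import Data.Vec using (Vec; []; _∷_; lookup; here; there)
open import Data.List using (List; []; _∷_; [_]; _++_; map; length; allFin; tabulate; cartesianProductWith)
open import Data.List.Properties using (length-tabulate; length-++; length-map)
open import Data.List.Membership.Propositional using () renaming (_∈_ to _∈ₗ_)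
open import Data.List.Membership.Propositional.Properties using (∈-map⁺; ∈-++⁺ˡ; ∈-++⁺ʳ)
open import Data.List.Relation.Unary.Any using (here; there)
open import Data.List.Relation.Unary.All as All using (All; []; _∷_)
open import Data.List.Relation.Unary.All.Properties using (map⁺; ++⁺)
open import Data.Product using (Σ; ∃; _×_; _,_; proj₁; proj₂)
open import Data.Sum using (inj₁; inj₂)
open import Function using (_∘_)
open import Relation.Nullary using (¬_; Dec; yes; no; contradiction)
open import Relation.Nullary.Decidable using (_×-dec_; _→-dec_; does; dec-true)
open import Relation.Binary.PropositionalEquality using (_≡_; refl; sym; trans; cong; cong₂; subst; module ≡-Reasoning)

private variable
  A B C : Set

-- Finite sums over lists.

∑ : List A → (A → ℕ) → ℕ
∑ []       f = 0
∑ (x ∷ xs) f = f x + ∑ xs f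

∑-mono : (xs : List A) {f g : A → ℕ} → (∀ x → f x ≤ g x) → ∑ xs f ≤ ∑ xs g
∑-mono []       f≤g = z≤n
∑-mono (x ∷ xs) f≤g = +-mono-≤ (f≤g x) (∑-mono xs f≤g)

∑-distribˡ : (xs : List A) (m : ℕ) (f : A → ℕ) → ∑ xs (λ x → m * f x) ≡ m * ∑ xs f
∑-distribˡ []       m f = sym (*-zeroʳ m)
∑-distribˡ (x ∷ xs) m f = trans (cong (m * f x +_) (∑-distribˡ xs m f)) (sym (*-distribˡ-+ m (f x) (∑ xs f)))

∑-const : (xs : List A) (c : ℕ) → ∑ xs (λ _ → c) ≡ length xs * c
∑-const []       c = refl
∑-const (x ∷ xs) c = cong (c +_) (∑-const xs c)

-- Probability estimates appear throughout as inequalities in ℕ; `m` is a cleared denominator.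
∑-bound-All : (xs : List A) {f : A → ℕ} {c : ℕ} (m : ℕ) → All (λ x → m * f x ≤ c) xs → m * ∑ xs f ≤ length xs * c
∑-bound-All []       m []          = ≤-reflexive (*-zeroʳ m)
∑-bound-All (x ∷ xs) {f} m (px ∷ pxs) = ≤-trans (≤-reflexive (*-distribˡ-+ m (f x) (∑ xs f)))
  (+-mono-≤ px (∑-bound-All xs m pxs))

∑-bound : (xs : List A) {f : A → ℕ} {c : ℕ} (m : ℕ) → (∀ x → m * f x ≤ c) → m * ∑ xs f ≤ length xs * c
∑-bound xs m f≤c = ∑-bound-All xs m (All.universal f≤c xs)

∑-≤length : (xs : List A) {f : A → ℕ} → (∀ x → f x ≤ 1) → ∑ xs f ≤ length xs
∑-≤length []       f≤1 = z≤n
∑-≤length (x ∷ xs) f≤1 = +-mono-≤ (f≤1 x) (∑-≤length xs f≤1)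

∑-zero : (xs : List A) {f : A → ℕ} → (∀ x → f x ≡ 0) → ∑ xs f ≡ 0
∑-zero []       f≡0 = refl
∑-zero (x ∷ xs) f≡0 = cong₂ _+_ (f≡0 x) (∑-zero xs f≡0)

∑-+ : (xs : List A) (f g : A → ℕ) → ∑ xs (λ x → f x + g x) ≡ ∑ xs f + ∑ xs g
∑-+ []       f g = refl
∑-+ (x ∷ xs) f g = trans (cong (f x + g x +_) (∑-+ xs f g)) (exchange (f x) (g x) (∑ xs f) (∑ xs g))
  where
  exchange : ∀ a b c d → a + b + (c + d) ≡ a + c + (b + d)
  exchange = solve-∀

∑-++ : (xs ys : List A) (f : A → ℕ) → ∑ (xs ++ ys) f ≡ ∑ xs f + ∑ ys f
∑-++ []       ys f = refl
∑-++ (x ∷ xs) ys f = trans (cong (f x +_) (∑-++ xs ys f)) (sym (+-assoc (f x) (∑ xs f) (∑ ys f)))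

∑-map : (h : B → A) (xs : List B) (f : A → ℕ) → ∑ (map h xs) f ≡ ∑ xs (f ∘ h)
∑-map h []       f = refl
∑-map h (x ∷ xs) f = cong (f (h x) +_) (∑-map h xs f)

∑-product : (h : B → C → A) (xs : List B) (ys : List C) (f : A → ℕ) →
  ∑ (cartesianProductWith h xs ys) f ≡ ∑ xs (λ x → ∑ ys (λ y → f (h x y)))
∑-product h []       ys f = refl
∑-product h (x ∷ xs) ys f = trans (∑-++ (map (h x) ys) (cartesianProductWith h xs ys) f)
  (cong₂ _+_ (∑-map (h x) ys f) (∑-product h xs ys f))

∑-swap : (xs : List A) (ys : List B) (f : A → B → ℕ) →
  ∑ xs (λ x → ∑ ys (f x)) ≡ ∑ ys (λ y → ∑ xs (λ x → f x y))
∑-swap []       ys f = sym (trans (∑-const ys 0) (*-zeroʳ (length ys)))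
∑-swap (x ∷ xs) ys f = trans (cong (∑ ys (f x) +_) (∑-swap xs ys f)) (sym (∑-+ ys (f x) _))

-- First-moment method: if the mean is below 1, not every value can be positive.
∑<length⇒∃-zero : (xs : List A) (f : A → ℕ) → ∑ xs f < length xs → ∃ λ x → f x ≡ 0
∑<length⇒∃-zero (x ∷ xs) f lt with f x in eq
... | zero  = x , eq
... | suc m = ∑<length⇒∃-zero xs f (≤-trans (s≤s (m≤n+m (∑ xs f) m)) (≤-pred lt))

∑≡0⇒≡0 : {xs : List A} (f : A → ℕ) → ∑ xs f ≡ 0 → ∀ {x} → x ∈ₗ xs → f x ≡ 0
∑≡0⇒≡0 {xs = x ∷ _} f eq (here refl) = m+n≡0⇒m≡0 (f x) eq
∑≡0⇒≡0 {xs = x ∷ _} f eq (there x∈xs) = ∑≡0⇒≡0 f (m+n≡0⇒n≡0 (f x) eq) x∈xs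

length≡∑1 : (xs : List A) → length xs ≡ ∑ xs (λ _ → 1)
length≡∑1 xs = sym (trans (∑-const xs 1) (*-identityʳ (length xs)))

length-product : (h : B → C → A) (xs : List B) (ys : List C) →
  length (cartesianProductWith h xs ys) ≡ length xs * length ys
length-product h xs ys = begin
  length (cartesianProductWith h xs ys)        ≡⟨ length≡∑1 (cartesianProductWith h xs ys) ⟩
  ∑ (cartesianProductWith h xs ys) (λ _ → 1)   ≡⟨ ∑-product h xs ys (λ _ → 1) ⟩
  ∑ xs (λ _ → ∑ ys (λ _ → 1))                  ≡⟨ ∑-const xs _ ⟩
  length xs * ∑ ys (λ _ → 1)                   ≡⟨ cong (length xs *_) (length≡∑1 ys) ⟨
  length xs * length ys                        ∎
  where open ≡-Reasoning

-- Meant for one coordinate of a row: the value `i₀` that continues a match has its own bound `c₀`,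
-- the other `n` values share `c`.
∑-tabulate-bound : (n : ℕ) (e : Fin (suc n) → A) (f : A → ℕ) (i₀ : Fin (suc n)) {c c₀ : ℕ} →
  (∀ x → f x ≤ c) → f (e i₀) ≤ c₀ → ∑ (tabulate e) f ≤ n * c + c₀
∑-tabulate-bound n e f zero {c} {c₀} f≤c f≤c₀ = begin
  f (e zero) + ∑ xs f                ≤⟨ +-mono-≤ f≤c₀ (∑-mono xs f≤c) ⟩
  c₀ + ∑ xs (λ _ → c)                ≡⟨ cong (c₀ +_) (∑-const xs c) ⟩
  c₀ + length xs * c                 ≡⟨ cong (λ l → c₀ + l * c) (length-tabulate (e ∘ suc)) ⟩
  c₀ + n * c                         ≡⟨ +-comm c₀ (n * c) ⟩
  n * c + c₀                         ∎
  where
  open ≤-Reasoning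
  xs = tabulate (e ∘ suc)
∑-tabulate-bound (suc n) e f (suc i₀) {c} {c₀} f≤c f≤c₀ = begin
  f (e zero) + ∑ (tabulate (e ∘ suc)) f  ≤⟨ +-mono-≤ (f≤c (e zero)) (∑-tabulate-bound n (e ∘ suc) f i₀ f≤c f≤c₀) ⟩
  c + (n * c + c₀)                       ≡⟨ +-assoc c (n * c) c₀ ⟨
  suc n * c + c₀                         ∎
  where open ≤-Reasoning

-- Subsets of `Fin N`: initial parts and enumeration by size.

first : ∀ {N} → ℕ → Subset N → Subset N
first zero    X             = ⊥
first (suc c) []            = []
first (suc c) (inside ∷ X)  = inside ∷ first c X
first (suc c) (outside ∷ X) = outside ∷ first (suc c) X

first⊆ : ∀ {N} c (X : Subset N) → first c X ⊆ X
first⊆ zero    X             x∈ = contradiction x∈ ∉⊥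
first⊆ (suc c) (inside ∷ X)  = s⊆s (first⊆ c X)
first⊆ (suc c) (outside ∷ X) = s⊆s (first⊆ (suc c) X)

∣first∣ : ∀ {N} c (X : Subset N) → c ≤ ∣ X ∣ → ∣ first c X ∣ ≡ c
∣first∣ {N} zero X           c≤        = ∣⊥∣≡0 N
∣first∣ (suc c) (inside ∷ X)  (s≤s c≤) = cong suc (∣first∣ c X c≤)
∣first∣ (suc c) (outside ∷ X) c≤       = ∣first∣ (suc c) X c≤

subsets : ∀ N → ℕ → List (Subset N)
subsets zero    zero    = [ [] ]
subsets zero    (suc n) = []
subsets (suc N) zero    = map (outside ∷_) (subsets N zero)
subsets (suc N) (suc n) = map (inside ∷_) (subsets N n) ++ map (outside ∷_) (subsets N (suc n))

∈-subsets : ∀ {N} (X : Subset N) → X ∈ₗ subsets N ∣ X ∣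
∈-subsets []            = here refl
∈-subsets (inside ∷ X)  = ∈-++⁺ˡ (∈-map⁺ (inside ∷_) (∈-subsets X))
∈-subsets (outside ∷ X) with ∣ X ∣ | ∈-subsets X
... | zero  | X∈ = ∈-map⁺ (outside ∷_) X∈
... | suc n | X∈ = ∈-++⁺ʳ (map (inside ∷_) (subsets _ n)) (∈-map⁺ (outside ∷_) X∈)

subsets-size : ∀ N n → All (λ X → ∣ X ∣ ≡ n) (subsets N n)
subsets-size zero    zero    = refl ∷ []
subsets-size zero    (suc n) = []
subsets-size (suc N) zero    = map⁺ (subsets-size N zero)
subsets-size (suc N) (suc n) = ++⁺ (map⁺ (All.map (cong suc) (subsets-size N n))) (map⁺ (subsets-size N (suc n)))

-- Pascal's rule for the two halves of the list, with N ^ n + N ^ (n + 1) = (N + 1) * N ^ n.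
length-subsets : ∀ N n → length (subsets N n) ≤ N ^ n
length-subsets zero    zero    = ≤-refl
length-subsets zero    (suc n) = z≤n
length-subsets (suc N) zero    = ≤-trans (≤-reflexive (length-map (outside ∷_) (subsets N zero))) (length-subsets N zero)
length-subsets (suc N) (suc n) = begin
  length (map (inside ∷_) (subsets N n) ++ map (outside ∷_) (subsets N (suc n)))
    ≡⟨ length-++ (map (inside ∷_) (subsets N n)) ⟩
  length (map (inside ∷_) (subsets N n)) + length (map (outside ∷_) (subsets N (suc n)))
    ≡⟨ cong₂ _+_ (length-map (inside ∷_) (subsets N n)) (length-map (outside ∷_) (subsets N (suc n))) ⟩
  length (subsets N n) + length (subsets N (suc n))
    ≤⟨ +-mono-≤ (length-subsets N n) (length-subsets N (suc n)) ⟩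
  suc N * N ^ n
    ≤⟨ *-monoʳ-≤ (suc N) (^-monoˡ-≤ n (n≤1+n N)) ⟩
  suc N ^ suc n ∎
  where open ≤-Reasoning

-- Sums over subsets of `Fin N`.

∑ₛ : ∀ {N} → Subset N → (Fin N → ℕ) → ℕ
∑ₛ []            f = 0
∑ₛ (inside ∷ S)  f = f zero + ∑ₛ S (f ∘ suc)
∑ₛ (outside ∷ S) f = ∑ₛ S (f ∘ suc)

∑ₛ-cong : ∀ {N} (S : Subset N) {f g : Fin N → ℕ} → (∀ i → i ∈ S → f i ≡ g i) → ∑ₛ S f ≡ ∑ₛ S g
∑ₛ-cong []            f≡g = refl
∑ₛ-cong (inside ∷ S)  f≡g = cong₂ _+_ (f≡g zero here) (∑ₛ-cong S (λ i i∈S → f≡g (suc i) (there i∈S)))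
∑ₛ-cong (outside ∷ S) f≡g = ∑ₛ-cong S (λ i i∈S → f≡g (suc i) (there i∈S))

∑ₛ-insert : ∀ {N} (S : Subset N) (t : Fin N) (f : Fin N → ℕ) → t ∉ S → ∑ₛ (S ∪ ⁅ t ⁆) f ≡ f t + ∑ₛ S f
∑ₛ-insert (inside ∷ S)  zero    f t∉S = contradiction here t∉S
∑ₛ-insert (outside ∷ S) zero    f t∉S = cong (λ S → f zero + ∑ₛ S (f ∘ suc)) (∪-identityʳ S)
∑ₛ-insert (inside ∷ S)  (suc t) f t∉S = trans
  (cong (f zero +_) (∑ₛ-insert S t (f ∘ suc) (t∉S ∘ there)))
  (exchange (f zero) (f (suc t)) (∑ₛ S (f ∘ suc)))
  where
  exchange : ∀ a b c → a + (b + c) ≡ b + (a + c)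
  exchange = solve-∀
∑ₛ-insert (outside ∷ S) (suc t) f t∉S = ∑ₛ-insert S t (f ∘ suc) (t∉S ∘ there)

∑ₛ-shift : ∀ {N} (S : Subset N) (c : ℕ) (f : Fin N → ℕ) → ∑ₛ S (λ i → c + f i) ≡ ∣ S ∣ * c + ∑ₛ S f
∑ₛ-shift []            c f = refl
∑ₛ-shift (inside ∷ S)  c f = trans (cong (c + f zero +_) (∑ₛ-shift S c (f ∘ suc)))
  (exchange c (f zero) (∣ S ∣ * c) (∑ₛ S (f ∘ suc)))
  where
  exchange : ∀ a b c d → a + b + (c + d) ≡ a + c + (b + d)
  exchange = solve-∀
∑ₛ-shift (outside ∷ S) c f = ∑ₛ-shift S c (f ∘ suc)

∣-∑ₛ : ∀ {N d} (S : Subset N) (f : Fin N → ℕ) → (∀ i → i ∈ S → d ∣ f i) → d ∣ ∑ₛ S f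
∣-∑ₛ {d = d} []    f d∣f = d ∣0
∣-∑ₛ (inside ∷ S)  f d∣f = ∣m∣n⇒∣m+n (d∣f zero here) (∣-∑ₛ S (f ∘ suc) (λ i i∈S → d∣f (suc i) (there i∈S)))
∣-∑ₛ (outside ∷ S) f d∣f = ∣-∑ₛ S (f ∘ suc) (λ i i∈S → d∣f (suc i) (there i∈S))

-- Counting rows that avoid prescribed patterns.

AgreeOn : ∀ {q N} → Subset N → (Fin N → Fin q) → Vec (Fin q) N → Set
AgreeOn S τ r = ∀ i → i ∈ S → lookup r i ≡ τ i

does-true : {P : Set} (P? : Dec P) → does P? ≡ true → P
does-true (yes p) _ = p

module Rows (q-1 h : ℕ) where

  q : ℕ
  q = suc q-1

  rows : ∀ N → List (Vec (Fin q) N)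
  rows zero    = [ [] ]
  rows (suc N) = cartesianProductWith _∷_ (allFin q) (rows N)

  length-rows : ∀ N → length (rows N) ≡ q ^ N
  length-rows zero    = refl
  length-rows (suc N) = trans (length-product _∷_ (allFin q) (rows N))
    (cong₂ _*_ (length-tabulate {n = q} (λ i → i)) (length-rows N))

  -- In the application `f` indicates the rows of a new vertex that leave `X` together with this
  -- vertex blue, and `τ S` holds entries that would make `S` plus the new vertex red. These entries
  -- depend on `S`, hence a target for each `S`.
  record Avoids {N} (X : Subset N) (τ : Subset N → Fin N → Fin q) (f : Vec (Fin q) N → ℕ) : Set where
    field
      ≤1    : ∀ r → f r ≤ 1
      avoid : ∀ S → S ⊆ X → ∣ S ∣ ≡ h → ∀ r → AgreeOn S (τ S) r → f r ≡ 0

  open Avoids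

  tail : ∀ {N b} {X : Subset N} {τ f} → Avoids (b ∷ X) τ f → ∀ x → Avoids X (λ S i → τ (outside ∷ S) (suc i)) (f ∘ (x ∷_))
  tail av x .≤1 r = av .≤1 (x ∷ r)
  tail av x .avoid S S⊆X ∣S∣ r agree = av .avoid (outside ∷ S) (out⊆ S⊆X) ∣S∣ (x ∷ r) λ where
    (suc i) (there i∈S) → agree i i∈S

  -- Rows are counted coordinate by coordinate.  In blockBound the current
  -- block consists of the next c elements of X, with target σ; as soon as a
  -- coordinate of it differs from σ, only the j later blocks matter.
  rowBound : ∀ {N} j (X : Subset N) {τ f} → Avoids X τ f → j * h ≤ ∣ X ∣ →
    (q ^ h) ^ j * ∑ (rows N) f ≤ (q ^ h ∸ 1) ^ j * q ^ N
  blockBound : ∀ {N} c j (X : Subset N) {τ f} (σ : Fin N → Fin q) → Avoids X τ f →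
    (∀ r → AgreeOn (first c X) σ r → f r ≡ 0) → c + j * h ≤ ∣ X ∣ →
    (q ^ h) ^ j * q ^ c * ∑ (rows N) f ≤ (q ^ c ∸ 1) * ((q ^ h ∸ 1) ^ j * q ^ N)

  rowBound {N} zero X av _ = *-monoʳ-≤ 1 (≤-trans (∑-≤length (rows N) (av .≤1)) (≤-reflexive (length-rows N)))
  rowBound {N} (suc j) X {τ} {f} av ≤∣X∣ = begin
    q ^ h * (q ^ h) ^ j * ∑ (rows N) f
      ≡⟨ cong (_* ∑ (rows N) f) (*-comm (q ^ h) _) ⟩
    (q ^ h) ^ j * q ^ h * ∑ (rows N) f
      -- The block is the least `h` elements of `X`, so the recursion on coordinates finishes it
      -- before reaching the next one and the blocks are disjoint.
      ≤⟨ blockBound h j X (τ (first h X)) av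
           (av .avoid (first h X) (first⊆ h X) (∣first∣ h X (m+n≤o⇒m≤o h ≤∣X∣))) ≤∣X∣ ⟩
    (q ^ h ∸ 1) * ((q ^ h ∸ 1) ^ j * q ^ N)
      ≡⟨ *-assoc (q ^ h ∸ 1) ((q ^ h ∸ 1) ^ j) (q ^ N) ⟨
    (q ^ h ∸ 1) * (q ^ h ∸ 1) ^ j * q ^ N ∎
    where open ≤-Reasoning

  -- The block is used up without a mismatch, so `hit` applies to every row and `f` vanishes; this
  -- is the factor q ^ 0 ∸ 1 = 0 of the bound.
  blockBound {N} zero j X {f = f} σ av hit ≤∣X∣ = begin
    (q ^ h) ^ j * 1 * ∑ (rows N) f
      ≡⟨ cong ((q ^ h) ^ j * 1 *_) (∑-zero (rows N) (λ r → hit r (λ i i∈ → contradiction i∈ ∉⊥))) ⟩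
    (q ^ h) ^ j * 1 * 0
      ≡⟨ *-zeroʳ ((q ^ h) ^ j * 1) ⟩
    0 ∎
    where open ≤-Reasoning
  blockBound (suc c) j [] σ av hit ()
  blockBound {suc N} (suc c) j (outside ∷ X) {f = f} σ av hit ≤∣X∣ = begin
    M * ∑ (rows (suc N)) f
      ≡⟨ cong (M *_) (∑-product _∷_ (allFin q) (rows N) f) ⟩
    M * ∑ (allFin q) (λ x → ∑ (rows N) (λ r → f (x ∷ r)))
      ≤⟨ ∑-bound (allFin q) M (λ x → blockBound (suc c) j X (σ ∘ suc) (tail av x)
           (λ r agree → hit (x ∷ r) λ where (suc i) (there i∈) → agree i i∈) ≤∣X∣) ⟩
    length (allFin q) * (P * (K * q ^ N))
      ≡⟨ cong (_* (P * (K * q ^ N))) (length-tabulate {n = q} (λ i → i)) ⟩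
    q * (P * (K * q ^ N))
      ≡⟨ exchange q P K (q ^ N) ⟩
    P * (K * (q * q ^ N)) ∎
    where
    open ≤-Reasoning
    M = (q ^ h) ^ j * q ^ suc c
    P = q ^ suc c ∸ 1
    K = (q ^ h ∸ 1) ^ j
    exchange : ∀ a b c d → a * (b * (c * d)) ≡ b * (c * (a * d))
    exchange = solve-∀
  blockBound {suc N} (suc c) j (inside ∷ X) {f = f} σ av hit ≤∣X∣ = begin
    M * ∑ (rows (suc N)) f
      ≡⟨ cong (M *_) (∑-product _∷_ (allFin q) (rows N) f) ⟩
    M * ∑ (allFin q) g
      ≡⟨ ∑-distribˡ (allFin q) M g ⟨
    ∑ (allFin q) (λ x → M * g x)
      -- The q - 1 values other than `σ zero` break the match and leave the `j` later blocks;
      -- `σ zero` leaves `c` coordinates of the block. The two add up because (q - 1) q^c + (q^c -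
      -- 1) = q^(c+1) - 1.
      ≤⟨ ∑-tabulate-bound q-1 (λ i → i) (λ x → M * g x) (σ zero) miss match ⟩
    q-1 * (q ^ suc c * Z) + q * ((q ^ c ∸ 1) * Z)
      ≤⟨ total (q ^ c) (m^n>0 q c) ⟩
    (q ^ suc c ∸ 1) * ((q ^ h ∸ 1) ^ j * (q * q ^ N)) ∎
    where
    open ≤-Reasoning
    M = (q ^ h) ^ j * q ^ suc c
    Z = (q ^ h ∸ 1) ^ j * q ^ N
    g : Fin q → ℕ
    g x = ∑ (rows N) (λ r → f (x ∷ r))
    exchange₁ : ∀ a b c → a * b * c ≡ b * (a * c)
    exchange₁ = solve-∀
    exchange₂ : ∀ a b c d → a * (b * c) * d ≡ b * (a * c * d)
    exchange₂ = solve-∀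
    miss : ∀ x → M * g x ≤ q ^ suc c * Z
    miss x = begin
      M * g x                             ≡⟨ exchange₁ ((q ^ h) ^ j) (q ^ suc c) (g x) ⟩
      q ^ suc c * ((q ^ h) ^ j * g x)     ≤⟨ *-monoʳ-≤ (q ^ suc c) (rowBound j X (tail av x)
                                               (m+n≤o⇒n≤o c (≤-pred ≤∣X∣))) ⟩
      q ^ suc c * Z                       ∎
    match : M * g (σ zero) ≤ q * ((q ^ c ∸ 1) * Z)
    match = begin
      M * g (σ zero)                           ≡⟨ exchange₂ ((q ^ h) ^ j) q (q ^ c) (g (σ zero)) ⟩
      q * ((q ^ h) ^ j * q ^ c * g (σ zero))   ≤⟨ *-monoʳ-≤ q (blockBound c j X (σ ∘ suc) (tail av (σ zero))
        (λ r agree → hit (σ zero ∷ r) λ where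
          zero    here       → refl
          (suc i) (there i∈) → agree i i∈) (≤-pred ≤∣X∣)) ⟩
      q * ((q ^ c ∸ 1) * Z)                    ∎
    total : ∀ y → 1 ≤ y → q-1 * (q * y * Z) + q * ((y ∸ 1) * Z) ≤ (q * y ∸ 1) * ((q ^ h ∸ 1) ^ j * (q * q ^ N))
    total (suc y) _ = ≤-reflexive (identity q-1 y ((q ^ h ∸ 1) ^ j) (q ^ N))
      where
      identity : ∀ p y k n → p * (suc p * suc y * (k * n)) + suc p * (y * (k * n)) ≡ (y + p * suc y) * (k * (suc p * n))
      identity = solve-∀

-- The matrix colouring and the absence of red half-graphs.

module Construction (g : ℕ) where

  h : ℕ
  h = suc (suc g)

  -- The argument is h² - 1 in a form for which `q` reduces to `h * h`, so one symbol of a row can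
  -- carry two residues.
  open Rows (suc g + suc g * h) h

  -- Row r of (r , w) lists, for each older vertex i, the pair of entries
  -- (0 , i) and (i , 0); both are residues modulo h.
  Matrix : ℕ → Set
  Matrix zero    = ⊤
  Matrix (suc N) = Vec (Fin q) N × Matrix N

  entry : ∀ {N} → Matrix N → Fin N → Fin N → ℕ
  entry {suc N} (r , w) zero    zero    = 0
  entry {suc N} (r , w) zero    (suc j) = toℕ (proj₁ (remQuot {h} h (lookup r j)))
  entry {suc N} (r , w) (suc i) zero    = toℕ (proj₂ (remQuot {h} h (lookup r i)))
  entry {suc N} (r , w) (suc i) (suc j) = entry w i j

  entry-diagonal : ∀ {N} (w : Matrix N) i → entry w i i ≡ 0
  entry-diagonal (r , w) zero    = refl
  entry-diagonal (r , w) (suc i) = entry-diagonal w i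

  Red : ∀ {N} → Matrix N → Subset N → Set
  Red w Y = ∀ v → v ∈ Y → h ∣ suc (∑ₛ Y (entry w v))

  Red? : ∀ {N} (w : Matrix N) Y → Dec (Red w Y)
  Red? w Y = all? (λ v → (v ∈? Y) →-dec (h ∣? suc (∑ₛ Y (entry w v))))

  colouring : ∀ {N} → Matrix N → Colouring N
  colouring w Y = does (Red? w Y)

  colouring-red : ∀ {N} (w : Matrix N) Y → colouring w Y ≡ true → Red w Y
  colouring-red w Y = does-true (Red? w Y)

  -- Summing the conditions at s over the h edges S ∪ {t} gives h ∣ ∑ₜ w(s,t),
  -- while T ∪ {s} requires h ∣ 1 + ∑ₜ w(s,t).
  no-red-half-graph : ∀ {N} (w : Matrix N) → ¬ RedHalfGraph (suc h) N (colouring w)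
  no-red-half-graph w (S , T , disjoint , ∣S∣ , ∣T∣ , S-red , s , s∈S , T-red) = contradiction (∣1⇒≡1 h∣1) λ ()
    where
    e : _ → ℕ
    e = entry w s
    h∣T : h ∣ ∑ₛ T e
    -- Since `T` has exactly `h` elements, the part `suc (∑ₛ S e)` common to all `t` contributes a
    -- multiple of `h`, which is subtracted.
    h∣T = ∣m+n∣m⇒∣n
      (subst (h ∣_) (trans (∑ₛ-shift T (suc (∑ₛ S e)) e) (cong (λ n → n * suc (∑ₛ S e) + ∑ₛ T e) ∣T∣))
        (∣-∑ₛ T (λ t → suc (∑ₛ S e) + e t) λ t t∈T →
          subst (λ n → h ∣ suc n)
            (trans (∑ₛ-insert S t e (λ t∈S → disjoint (t , x∈p∩q⁺ (t∈S , t∈T)))) (+-comm (e t) (∑ₛ S e)))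
            (colouring-red w (S ∪ ⁅ t ⁆) (S-red t t∈T) s (x∈p∪q⁺ (inj₁ s∈S)))))
      (m∣m*n (suc (∑ₛ S e)))
    h∣1+T : h ∣ suc (∑ₛ T e)
    h∣1+T = subst (λ n → h ∣ suc n)
      (trans (∑ₛ-insert T s e (λ s∈T → disjoint (s , x∈p∩q⁺ (s∈S , s∈T)))) (cong (_+ ∑ₛ T e) (entry-diagonal w s)))
      (colouring-red w (T ∪ ⁅ s ⁆) T-red s (x∈p∪q⁺ (inj₂ (x∈⁅x⁆ s))))
    h∣1 : h ∣ 1
    h∣1 = ∣m+n∣m⇒∣n (subst (h ∣_) (+-comm 1 (∑ₛ T e)) h∣1+T) h∣T

  -- Completing an `h`-set to a red edge.

  residue : ℕ → Fin h
  residue x = opposite (x mod h)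

  -- `opposite` turns x mod h into h - 1 - (x mod h), which together with x gives -1 modulo `h`.
  residue-∣ : ∀ x → h ∣ suc (toℕ (residue x) + x)
  residue-∣ x = divides (suc (x / h)) (begin
    suc (toℕ (residue x) + x)
      ≡⟨ cong (λ n → suc (n + x)) (trans (opposite-prop (x mod h)) (cong (λ n → h ∸ suc n) (toℕ-fromℕ< (m%n<n x h)))) ⟩
    suc (h ∸ suc (x % h) + x)
      ≡⟨ cong (λ n → suc (h ∸ suc (x % h) + n)) (m≡m%n+[m/n]*n x h) ⟩
    suc (h ∸ suc (x % h) + (x % h + x / h * h))
      ≡⟨ exchange (h ∸ suc (x % h)) (x % h) (x / h * h) ⟩
    h ∸ suc (x % h) + suc (x % h) + x / h * h
      ≡⟨ cong (_+ x / h * h) (m∸n+n≡m (m%n<n x h)) ⟩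
    suc (x / h) * h ∎)
    where
    open ≡-Reasoning
    exchange : ∀ a b c → suc (a + (b + c)) ≡ a + suc b + c
    exchange = solve-∀

  -- A simple row whose sum over a nonempty `S` is -1 modulo `h`: the value h - 1 at the least
  -- element of `S` and 0 elsewhere.
  spike : ∀ {N} → Subset N → Fin N → Fin h
  spike (inside ∷ S)  zero    = fromℕ (suc g)
  spike (inside ∷ S)  (suc i) = zero
  spike (outside ∷ S) zero    = zero
  spike (outside ∷ S) (suc i) = spike S i

  ∑ₛ-spike : ∀ {N n} (S : Subset N) → ∣ S ∣ ≡ suc n → ∑ₛ S (toℕ ∘ spike S) ≡ suc g
  ∑ₛ-spike (inside ∷ S)  ∣S∣ = trans (cong₂ _+_ (toℕ-fromℕ (suc g)) (∑ₛ-zero S)) (+-identityʳ (suc g))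
    where
    ∑ₛ-zero : ∀ {N} (S : Subset N) → ∑ₛ S (λ _ → 0) ≡ 0
    ∑ₛ-zero []            = refl
    ∑ₛ-zero (inside ∷ S)  = ∑ₛ-zero S
    ∑ₛ-zero (outside ∷ S) = ∑ₛ-zero S
  ∑ₛ-spike (outside ∷ S) ∣S∣ = ∑ₛ-spike S ∣S∣

  completion : ∀ {N} → Matrix N → Subset N → Fin N → Fin q
  completion w S i = combine (spike S i) (residue (∑ₛ S (entry w i)))

  -- The spike settles the condition at the new vertex. The condition at an old vertex i involves
  -- only one new entry, in column 0 of its row, so the conditions can be met independently, each by
  -- its `residue`.
  completion-red : ∀ {N} (w : Matrix N) S (r : Vec (Fin q) N) → ∣ S ∣ ≡ h → AgreeOn S (completion w S) r →
    Red (r , w) (inside ∷ S)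
  completion-red w S r ∣S∣ agree zero    here       = subst (λ n → h ∣ suc n) (sym sum) (divides 1 (sym (*-identityˡ h)))
    where
    sum : ∑ₛ S (λ j → toℕ (proj₁ (remQuot {h} h (lookup r j)))) ≡ suc g
    sum = trans (∑ₛ-cong S λ j j∈S → cong toℕ (trans
        (cong (proj₁ ∘ remQuot {h} h) (agree j j∈S))
        (cong proj₁ (remQuot-combine (spike S j) (residue (∑ₛ S (entry w j)))))))
      (∑ₛ-spike S ∣S∣)
  completion-red w S r ∣S∣ agree (suc i) (there i∈S) = subst (λ x → h ∣ suc (x + ∑ₛ S (entry w i))) (sym eq) (residue-∣ (∑ₛ S (entry w i)))
    where
    eq : toℕ (proj₂ (remQuot {h} h (lookup r i))) ≡ toℕ (residue (∑ₛ S (entry w i)))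
    eq = cong toℕ (trans (cong (proj₂ ∘ remQuot {h} h) (agree i i∈S)) (cong proj₂ (remQuot-combine (spike S i) (residue (∑ₛ S (entry w i))))))

  -- Counting the matrices that leave a set blue.

  RedWithin : ∀ {N} → Matrix N → Subset N → Set
  RedWithin w X = ∃ λ Y → Y ⊆ X × ∣ Y ∣ ≡ suc h × Red w Y

  RedWithin? : ∀ {N} (w : Matrix N) X → Dec (RedWithin w X)
  RedWithin? w X = anySubset? λ Y → (Y ⊆? X) ×-dec (∣ Y ∣ ≟ suc h) ×-dec Red? w Y

  RedWithin-cons : ∀ {N b r} {w : Matrix N} {X} → RedWithin w X → RedWithin (r , w) (b ∷ X)
  RedWithin-cons (Y , Y⊆X , ∣Y∣ , red) = outside ∷ Y , out⊆ Y⊆X , ∣Y∣ , λ where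
    (suc v) (there v∈Y) → red v v∈Y

  blue : ∀ {N} → Matrix N → Subset N → ℕ
  blue w X with RedWithin? w X
  ... | yes _ = 0
  ... | no  _ = 1

  blue≤1 : ∀ {N} (w : Matrix N) X → blue w X ≤ 1
  blue≤1 w X with RedWithin? w X
  ... | yes _ = z≤n
  ... | no  _ = ≤-refl

  RedWithin⇒blue≡0 : ∀ {N} (w : Matrix N) X → RedWithin w X → blue w X ≡ 0
  RedWithin⇒blue≡0 w X red with RedWithin? w X
  ... | yes _   = refl
  ... | no ¬red = contradiction red ¬red

  blue≡0⇒RedWithin : ∀ {N} (w : Matrix N) X → blue w X ≡ 0 → RedWithin w X
  blue≡0⇒RedWithin w X eq with RedWithin? w X
  ... | yes red = red

  blue-cons : ∀ {N} b (w : Matrix N) X r → blue (r , w) (b ∷ X) ≤ blue w X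
  blue-cons b w X r with RedWithin? w X
  ... | yes red = ≤-reflexive (RedWithin⇒blue≡0 (r , w) (b ∷ X) (RedWithin-cons red))
  ... | no  _   = blue≤1 (r , w) (b ∷ X)

  a : ℕ
  a = q ^ h ∸ 1

  -- Conditional step: given the older matrix, the new vertex keeps the set blue with probability at
  -- most (1 - q^(-h))^j. If `X` already contains a red edge, both sides are 0.
  rows-blue : ∀ {N} j (w : Matrix N) X → j * h ≤ ∣ X ∣ →
    (q ^ h) ^ j * ∑ (rows N) (λ r → blue (r , w) (inside ∷ X)) ≤ a ^ j * q ^ N * blue w X
  rows-blue {N} j w X ≤∣X∣ with RedWithin? w X
  ... | yes red = ≤-trans (≤-reflexive (trans
      (cong ((q ^ h) ^ j *_) (∑-zero (rows N) λ r → RedWithin⇒blue≡0 (r , w) (inside ∷ X) (RedWithin-cons red)))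
      (*-zeroʳ ((q ^ h) ^ j)))) z≤n
  ... | no _ = ≤-trans (rowBound j X {τ = completion w} av ≤∣X∣) (≤-reflexive (sym (*-identityʳ _)))
    where
    av : Avoids X (completion w) (λ r → blue (r , w) (inside ∷ X))
    av .Avoids.≤1 r = blue≤1 (r , w) (inside ∷ X)
    av .Avoids.avoid S S⊆X ∣S∣ r agree = RedWithin⇒blue≡0 (r , w) (inside ∷ X)
      (inside ∷ S , s⊆s S⊆X , cong suc ∣S∣ , completion-red w S r ∣S∣ agree)

  -- The older matrix is the outer factor, so that the inner sum exposes the new vertex with
  -- everything else fixed.
  matrices : ∀ N → List (Matrix N)
  matrices zero    = [ tt ]
  matrices (suc N) = cartesianProductWith (λ w r → r , w) (matrices N) (rows N)

  length-matrices-suc : ∀ N → length (matrices (suc N)) ≡ length (matrices N) * q ^ N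
  length-matrices-suc N = trans (length-product (λ w r → r , w) (matrices N) (rows N))
    (cong (length (matrices N) *_) (length-rows N))

  length-matrices>0 : ∀ N → 0 < length (matrices N)
  length-matrices>0 zero    = ≤-refl
  length-matrices>0 (suc N) = ≤-trans (*-mono-≤ (length-matrices>0 N) (m^n>0 q N)) (≤-reflexive (sym (length-matrices-suc N)))

  -- Each vertex of `X` exposed after `j * h` others contributes the factor (1 - q^(-h))^j; the
  -- first `j * h` contribute nothing, hence the truncated subtraction in the exponent.
  matrices-blue : ∀ {N} j (X : Subset N) →
    (q ^ h) ^ ((∣ X ∣ ∸ j * h) * j) * ∑ (matrices N) (λ w → blue w X)
      ≤ a ^ ((∣ X ∣ ∸ j * h) * j) * length (matrices N)
  matrices-blue {zero} j [] rewrite 0∸n≡0 (j * h) = *-monoʳ-≤ 1 (∑-≤length [ tt ] (λ w → blue≤1 w []))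
  matrices-blue {suc N} j (outside ∷ X) = begin
    D * ∑ (matrices (suc N)) (λ w → blue w (outside ∷ X))
      ≡⟨ cong (D *_) (∑-product (λ w r → r , w) (matrices N) (rows N) _) ⟩
    D * ∑ (matrices N) (λ w → ∑ (rows N) (λ r → blue (r , w) (outside ∷ X)))
      ≤⟨ *-monoʳ-≤ D (∑-mono (matrices N) λ w → ≤-trans
           -- A vertex outside the set cannot destroy a red edge, so each of the q^N new rows counts
           -- at most `blue w X`.
           (∑-mono (rows N) (blue-cons outside w X))
           (≤-reflexive (trans (∑-const (rows N) (blue w X)) (cong (_* blue w X) (length-rows N))))) ⟩
    D * ∑ (matrices N) (λ w → q ^ N * blue w X)
      ≡⟨ cong (D *_) (∑-distribˡ (matrices N) (q ^ N) _) ⟩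
    D * (q ^ N * ∑ (matrices N) (λ w → blue w X))
      ≡⟨ exchange₁ D (q ^ N) _ ⟩
    D * ∑ (matrices N) (λ w → blue w X) * q ^ N
      ≤⟨ *-monoˡ-≤ (q ^ N) (matrices-blue j X) ⟩
    a ^ e * length (matrices N) * q ^ N
      ≡⟨ *-assoc (a ^ e) (length (matrices N)) (q ^ N) ⟩
    a ^ e * (length (matrices N) * q ^ N)
      ≡⟨ cong (a ^ e *_) (length-matrices-suc N) ⟨
    a ^ e * length (matrices (suc N)) ∎
    where
    open ≤-Reasoning
    e = (∣ X ∣ ∸ j * h) * j
    D = (q ^ h) ^ e
    exchange₁ : ∀ a b c → a * (b * c) ≡ a * c * b
    exchange₁ = solve-∀
  matrices-blue {suc N} j (inside ∷ X) with j * h ≤? ∣ X ∣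
  -- Too few vertices so far: the exponent is still 0 and the trivial bound suffices.
  ... | no ≰ rewrite m≤n⇒m∸n≡0 (≰⇒> ≰) = *-monoʳ-≤ 1 (∑-≤length (matrices (suc N)) (λ w → blue≤1 w (inside ∷ X)))
  -- From here on the subtraction is exact, so the new vertex raises the exponent by exactly `j`.
  ... | yes ≤∣X∣ rewrite +-∸-assoc 1 ≤∣X∣ = begin
    (q ^ h) ^ (j + e) * ∑ (matrices (suc N)) (λ w → blue w (inside ∷ X))
      ≡⟨ cong₂ _*_ (trans (cong ((q ^ h) ^_) (+-comm j e)) (^-distribˡ-+-* (q ^ h) e j))
           (∑-product (λ w r → r , w) (matrices N) (rows N) _) ⟩
    D * (q ^ h) ^ j * ∑ (matrices N) (λ w → ∑ (rows N) (λ r → blue (r , w) (inside ∷ X)))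
      ≡⟨ *-assoc D ((q ^ h) ^ j) _ ⟩
    D * ((q ^ h) ^ j * ∑ (matrices N) (λ w → ∑ (rows N) (λ r → blue (r , w) (inside ∷ X))))
      ≡⟨ cong (D *_) (∑-distribˡ (matrices N) ((q ^ h) ^ j) _) ⟨
    D * ∑ (matrices N) (λ w → (q ^ h) ^ j * ∑ (rows N) (λ r → blue (r , w) (inside ∷ X)))
      ≤⟨ *-monoʳ-≤ D (∑-mono (matrices N) λ w → rows-blue j w X ≤∣X∣) ⟩
    D * ∑ (matrices N) (λ w → a ^ j * q ^ N * blue w X)
      ≡⟨ cong (D *_) (∑-distribˡ (matrices N) (a ^ j * q ^ N) _) ⟩
    D * (a ^ j * q ^ N * ∑ (matrices N) (λ w → blue w X))
      ≡⟨ exchange₁ D (a ^ j * q ^ N) _ ⟩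
    a ^ j * q ^ N * (D * ∑ (matrices N) (λ w → blue w X))
      ≤⟨ *-monoʳ-≤ (a ^ j * q ^ N) (matrices-blue j X) ⟩
    a ^ j * q ^ N * (a ^ e * length (matrices N))
      ≡⟨ exchange₂ (a ^ j) (q ^ N) (a ^ e) (length (matrices N)) ⟩
    a ^ j * a ^ e * (length (matrices N) * q ^ N)
      ≡⟨ cong₂ _*_ (^-distribˡ-+-* a j e) (length-matrices-suc N) ⟨
    a ^ (j + e) * length (matrices (suc N)) ∎
    where
    open ≤-Reasoning
    e = (∣ X ∣ ∸ j * h) * j
    D = (q ^ h) ^ e
    exchange₁ : ∀ a b c → a * (b * c) ≡ b * (a * c)
    exchange₁ = solve-∀
    exchange₂ : ∀ a b c d → a * b * (c * d) ≡ a * c * (d * b)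
    exchange₂ = solve-∀

  -- The union bound.

  union-bound : ∀ {N n} j → (let e = (n ∸ j * h) * j) → N ^ n * a ^ e < (q ^ h) ^ e →
    ∃ λ (w : Matrix N) → ∀ X → ∣ X ∣ ≡ n → RedWithin w X
  union-bound {N} {n} j small = w , λ X ∣X∣ → blue≡0⇒RedWithin w X
    (∑≡0⇒≡0 (blue w) w-zero (subst (λ m → X ∈ₗ subsets N m) ∣X∣ (∈-subsets X)))
    where
    open ≤-Reasoning
    e = (n ∸ j * h) * j
    total : Matrix N → ℕ
    total w = ∑ (subsets N n) (blue w)
    L = length (matrices N)
    -- The expected number of blue n-sets is below 1, with denominators cleared; hence some matrix
    -- has none.
    scaled : (q ^ h) ^ e * ∑ (matrices N) total < (q ^ h) ^ e * L
    scaled = begin-strict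
      (q ^ h) ^ e * ∑ (matrices N) total
        ≡⟨ cong ((q ^ h) ^ e *_) (∑-swap (matrices N) (subsets N n) blue) ⟩
      (q ^ h) ^ e * ∑ (subsets N n) (λ X → ∑ (matrices N) (λ w → blue w X))
        ≤⟨ ∑-bound-All (subsets N n) ((q ^ h) ^ e)
             (All.map (λ {X} → λ { refl → matrices-blue j X }) (subsets-size N n)) ⟩
      length (subsets N n) * (a ^ e * L)
        ≤⟨ *-monoˡ-≤ (a ^ e * L) (length-subsets N n) ⟩
      N ^ n * (a ^ e * L)
        ≡⟨ *-assoc (N ^ n) (a ^ e) L ⟨
      N ^ n * a ^ e * L
        <⟨ *-monoˡ-< L {{>-nonZero (length-matrices>0 N)}} small ⟩
      (q ^ h) ^ e * L ∎
    found = ∑<length⇒∃-zero (matrices N) total (*-cancelˡ-< ((q ^ h) ^ e) _ _ scaled)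
    w = proj₁ found
    w-zero = proj₂ found

  no-blue-clique : ∀ {N n} (w : Matrix N) → (∀ X → ∣ X ∣ ≡ n → RedWithin w X) → ¬ BlueClique (suc h) n N (colouring w)
  no-blue-clique w within (X , ∣X∣ , X-blue) with within X ∣X∣
  ... | Y , Y⊆X , ∣Y∣ , red with trans (sym (dec-true (Red? w Y) red)) (X-blue Y Y⊆X ∣Y∣)
  ... | ()

-- Numerical estimates.

*-^-≤ : ∀ {c x y} v → c * x ≤ y → c ^ v * x ^ v ≤ y ^ v
*-^-≤ zero          _    = ≤-refl
*-^-≤ {c} {x} {y} (suc v) cx≤y = ≤-trans (≤-reflexive (exchange c x (c ^ v) (x ^ v))) (*-mono-≤ cx≤y (*-^-≤ v cx≤y))
  where
  exchange : ∀ a b c d → a * c * (b * d) ≡ a * b * (c * d)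
  exchange = solve-∀

-- Bernoulli's inequality (1 + 1/a)^n ≥ 1 + n/a, multiplied by a^(n+1).
bernoulli : ∀ a n → (a + n) * a ^ n ≤ a * suc a ^ n
bernoulli a zero    = ≤-reflexive (cong (_* 1) (+-identityʳ a))
bernoulli a (suc n) = begin
  (a + suc n) * (a * a ^ n)               ≤⟨ m≤m+n _ (n * a ^ n) ⟩
  (a + suc n) * (a * a ^ n) + n * a ^ n   ≡⟨ identity a n (a ^ n) ⟩
  suc a * ((a + n) * a ^ n)               ≤⟨ *-monoʳ-≤ (suc a) (bernoulli a n) ⟩
  suc a * (a * suc a ^ n)                 ≡⟨ exchange (suc a) a (suc a ^ n) ⟩
  a * suc a ^ suc n                       ∎
  where
  open ≤-Reasoning
  identity : ∀ a n p → (a + suc n) * (a * p) + n * p ≡ suc a * ((a + n) * p)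
  identity = solve-∀
  exchange : ∀ a b c → a * (b * c) ≡ b * (a * c)
  exchange = solve-∀

-- Bernoulli with both parameters equal to `m`, that is (1 + 1/m)^m ≥ 2.
2*m^m≤[1+m]^m : ∀ m .{{_ : NonZero m}} → 2 * m ^ m ≤ suc m ^ m
2*m^m≤[1+m]^m m = *-cancelˡ-≤ m (≤-trans (≤-reflexive (identity m (m ^ m))) (bernoulli m m))
  where
  identity : ∀ m p → m * (2 * p) ≡ (m + m) * p
  identity = solve-∀

2^v*m^[m*v]≤[1+m]^[m*v] : ∀ m v .{{_ : NonZero m}} → 2 ^ v * m ^ (m * v) ≤ suc m ^ (m * v)
2^v*m^[m*v]≤[1+m]^[m*v] m v = begin
  2 ^ v * m ^ (m * v)   ≡⟨ cong (2 ^ v *_) (^-*-assoc m m v) ⟨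
  2 ^ v * (m ^ m) ^ v   ≤⟨ *-^-≤ v (2*m^m≤[1+m]^m m) ⟩
  (suc m ^ m) ^ v       ≡⟨ ^-*-assoc (suc m) m v ⟩
  suc m ^ (m * v)       ∎
  where open ≤-Reasoning

-- With w = n ∸ jh rows of weight j = 2au each, the exponent is a · 2uw, and
-- (1 + 1/a)ᵃ ≥ 2 turns it into a gain of 2^(2uw) ≥ 2^(un).
union-bound-small : ∀ a h u n .{{_ : NonZero a}} .{{_ : NonZero n}} →
  (let j = 2 * (a * u); e = (n ∸ j * h) * j) → 2 * (j * h) ≤ n →
  (2 ^ u ∸ 1) ^ n * a ^ e < suc a ^ e
union-bound-small a h u n 2jh≤n = begin-strict
  -- Strictness comes from taking 2^u - 1 vertices instead of 2^u, and uses n > 0.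
  (2 ^ u ∸ 1) ^ n * a ^ e         <⟨ *-monoˡ-< (a ^ e) {{m^n≢0 a e}} (^-monoˡ-< n pred<) ⟩
  (2 ^ u) ^ n * a ^ e             ≡⟨ cong (_* a ^ e) (^-*-assoc 2 u n) ⟩
  2 ^ (u * n) * a ^ e             ≤⟨ *-monoˡ-≤ (a ^ e) (^-monoʳ-≤ 2 (*-monoʳ-≤ u n≤2w)) ⟩
  2 ^ (u * (2 * w)) * a ^ e       ≡⟨ cong (λ x → 2 ^ (u * (2 * w)) * a ^ x) e≡ ⟩
  2 ^ (u * (2 * w)) * a ^ (a * (u * (2 * w)))
                                  ≤⟨ 2^v*m^[m*v]≤[1+m]^[m*v] a (u * (2 * w)) ⟩
  suc a ^ (a * (u * (2 * w)))     ≡⟨ cong (suc a ^_) e≡ ⟨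
  suc a ^ e                       ∎
  where
  open ≤-Reasoning
  j = 2 * (a * u)
  w = n ∸ j * h
  e = w * j
  pred< : 2 ^ u ∸ 1 < 2 ^ u
  pred< = ≤-reflexive (m+[n∸m]≡n (m^n>0 2 u))
  -- The hypothesis keeps j h at most n / 2, so at least half of the n vertices contribute.
  n≤2w : n ≤ 2 * w
  n≤2w = begin
    n                              ≡⟨ m+n∸n≡m n n ⟨
    n + n ∸ n                      ≤⟨ ∸-monoʳ-≤ (n + n) 2jh≤n ⟩
    n + n ∸ 2 * (j * h)            ≡⟨ cong (λ x → n + x ∸ 2 * (j * h)) (+-identityʳ n) ⟨
    2 * n ∸ 2 * (j * h)            ≡⟨ *-distribˡ-∸ 2 n (j * h) ⟨
    2 * w                          ∎
  e≡ : e ≡ a * (u * (2 * w))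
  e≡ = identity w a u
    where
    identity : ∀ w a u → w * (2 * (a * u)) ≡ a * (u * (2 * w))
    identity = solve-∀

-- Choice of parameters and the lower bound.

half-graph-lower-bound : ∀ g a .{{_ : NonZero a}} → (let h = 2 + g) → suc a ≡ (h * h) ^ h →
  ∀ n → 4 * a * h ≤ n →
  Σ ℕ λ N → 2 ^ n < suc N ^ (2 * (4 * a * h)) ×
  Σ (Colouring N) λ χ → ¬ RedHalfGraph (suc h) N χ × ¬ BlueClique (suc h) n N χ
half-graph-lower-bound g a 1+a≡q^h n m≤n = 2 ^ u ∸ 1 , large , colouring w , no-red-half-graph w , no-blue-clique w within
  where
  open Construction g hiding (a; h)
  open ≤-Reasoning
  h = 2 + g
  -- Chosen so that 2 j h = u m, which is at most n for u = n / m rounded down.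
  m = 4 * a * h
  instance
    m≢0 : NonZero m
    m≢0 = m*n≢0 (4 * a) h {{m*n≢0 4 a}}
    n≢0 : NonZero n
    n≢0 = >-nonZero (≤-trans (>-nonZero⁻¹ m) m≤n)
  u = n / m
  j = 2 * (a * u)
  e = (n ∸ j * h) * j
  large : 2 ^ n < suc (2 ^ u ∸ 1) ^ (2 * m)
  large = begin-strict
    -- Rounding n / m down loses less than m, and u is at least 1, so n < 2 u m; this is why the
    -- exponent is 2m.
    2 ^ n                          <⟨ ^-monoʳ-< 2 ≤-refl n<u*2m ⟩
    2 ^ (u * (2 * m))              ≡⟨ ^-*-assoc 2 u (2 * m) ⟨
    (2 ^ u) ^ (2 * m)              ≡⟨ cong (_^ (2 * m)) (m+[n∸m]≡n (m^n>0 2 u)) ⟨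
    suc (2 ^ u ∸ 1) ^ (2 * m)      ∎
    where
    n<u*2m : n < u * (2 * m)
    n<u*2m = begin-strict
      n                ≡⟨ m≡m%n+[m/n]*n n m ⟩
      n % m + u * m    <⟨ +-monoˡ-< (u * m) (m%n<n n m) ⟩
      m + u * m        ≤⟨ +-monoˡ-≤ (u * m) (m≤n*m m u {{>-nonZero (m≥n⇒m/n>0 m≤n)}}) ⟩
      u * m + u * m    ≡⟨ identity u m ⟩
      u * (2 * m)      ∎
      where
      identity : ∀ u m → u * m + u * m ≡ u * (2 * m)
      identity = solve-∀
  2jh≤n : 2 * (j * h) ≤ n
  2jh≤n = ≤-trans (≤-reflexive (identity a u h)) (m/n*n≤m n m)
    where
    identity : ∀ a u h → 2 * (2 * (a * u) * h) ≡ u * (4 * a * h)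
    identity = solve-∀
  found = union-bound {2 ^ u ∸ 1} {n} j
    -- The numerical estimate is about the pair `a`, `suc a`; replacing `suc a` by q^h turns `a`
    -- into q^h ∸ 1.
    (subst (λ b → (2 ^ u ∸ 1) ^ n * (b ∸ 1) ^ e < b ^ e) 1+a≡q^h (union-bound-small a h u n 2jh≤n))
  w = proj₁ found
  within = proj₂ found

theorem6 : (k : ℕ) → 3 ≤ k →
    Σ ℕ λ d → 1 ≤ d × Σ ℕ λ n₀ → (n : ℕ) → n₀ ≤ n →
    Σ ℕ λ N → 2 ^ n < (suc N) ^ d ×
    Σ (Colouring N) λ χ → ¬ RedHalfGraph k N χ × ¬ BlueClique k n N χ
theorem6 (suc (suc (suc g))) (s≤s (s≤s (s≤s z≤n))) =
  -- With d = 8 a h the constant is c = 1/d: a colouring on N vertices gives a Ramsey number of at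
  -- least N + 1 > 2^(n/d). The threshold 4 a h makes u positive.
  2 * (4 * a * h) , 1≤d , 4 * a * h , half-graph-lower-bound g a (m+[n∸m]≡n (≤-trans (s≤s z≤n) 2≤q^h))
  where
  h = 2 + g
  a = (h * h) ^ h ∸ 1
  2≤q^h : 2 ≤ (h * h) ^ h
  2≤q^h = *-mono-≤ {2} {h * h} {1} (s≤s (s≤s z≤n)) (m^n>0 (h * h) (1 + g))
  instance
    a≢0 : NonZero a
    a≢0 = >-nonZero (∸-monoˡ-≤ 1 2≤q^h)
  1≤d : 1 ≤ 2 * (4 * a * h)
  1≤d = >-nonZero⁻¹ _ {{m*n≢0 2 (4 * a * h) {{_}} {{m*n≢0 (4 * a) h {{m*n≢0 4 a}}}}}}
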